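{- Let $r,s$ be coprime positive integers with $2\nmid s$ and $1\le s<r/2$. Let $\Delta_2=s(r-s)(2r-s)$ and define $p_{3,r-s}(n)$ by $$\sum_{n=0}^\infty p_{3,r-s}(n)q^n=\frac{1}{(1-q^s)(1-q^{r-s})(1-q^{2r-s})}.$$ Then for all integers $n\ge 0$, $$P_{2,r-s}(n)+C^{d}_{3,r-s}\ \le\ p_{3,r-s}(n)\ \le\ P_{2,r-s}(n)+C^{u}_{3,r-s},$$ where $$\begin{aligned} P_{2,r-s}(n)&=\frac{1}{2\Delta_2}\left(-1+n^2+3r+n(3r-s)-s\right),\\ C^{u}_{3,r-s}&=\frac{1}{2\Delta_2}\Big(r^3(4s^2-2s)+r^2(-10s^3+3s^2+4s)+r(8s^4-s^3-6s^2-2s-2)\\ &\qquad\quad-2s^5+2s^3+2s^2+s+1\Big),\\ C^{d}_{3,r-s}&=\frac{1}{2\Delta_2}\Big(r^3(-4s^2-2s)+r^2(10s^3+3s^2)+r(-8s^4-s^3+2s-2)+2s^5-2s^2+s+1\Big). \end{aligned}$$ -}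

module Defs where

open import Data.Bool.Base using (if_then_else_)
open import Data.Fin.Base using (toℕ)
open import Data.Integer.Base using (ℤ; +_; -_; _+_; _-_; _*_; _^_; 0ℤ; 1ℤ)
open import Data.Integer.Properties using (+-0-commutativeMonoid)
open import Data.Nat.Base as ℕ using (ℕ; _∸_; NonZero)
import Data.Nat.Properties as ℕ
open import Data.Rational.Base using (ℚ; _/_)
open import Relation.Binary.PropositionalEquality using (_≡_; _≗_)
open import Relation.Nullary.Decidable using (does)
open import Algebra.Properties.CommutativeMonoid.Sum +-0-commutativeMonoid
  using (sum-syntax)

-- Formal power series in q over ℤ, as coefficient sequences compared
-- pointwise.
Series : Set
Series = ℕ → ℤ

-- The monomial q^ a.
q^_ : ℕ → Series
(q^ a) n = if does (n ℕ.≟ a) then 1ℤ else 0ℤ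

𝟙 : Series
𝟙 = q^ 0

infixl 6 _⊖_
infixl 7 _⊛_

_⊖_ : Series → Series → Series
(f ⊖ g) n = f n - g n

-- Cauchy product.
_⊛_ : Series → Series → Series
(f ⊛ g) n = ∑[ i < ℕ.suc n ] (f (toℕ i) * g (n ∸ toℕ i))

-- f = 1 / g.  In the intended use g has constant term 1, so that exactly
-- one such f exists.
_IsReciprocalOf_ : Series → Series → Set
f IsReciprocalOf g = f ⊛ g ≗ 𝟙

-- In everything below s < r is intended, so that ∸ is ordinary subtraction.

denominator : ℕ → ℕ → Series
denominator r s =
  (𝟙 ⊖ q^ s) ⊛ (𝟙 ⊖ q^ (r ∸ s)) ⊛ (𝟙 ⊖ q^ (2 ℕ.* r ∸ s))

Δ₂ : ℕ → ℕ → ℕ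
Δ₂ r s = s ℕ.* (r ∸ s) ℕ.* (2 ℕ.* r ∸ s)

Δ₂-nonZero : ∀ r s → 1 ℕ.≤ s → 2 ℕ.* s ℕ.< r → NonZero (Δ₂ r s)
Δ₂-nonZero r s 1≤s 2s<r =
  ℕ.m*n≢0 (s ℕ.* (r ∸ s)) (2 ℕ.* r ∸ s)
    {{ℕ.m*n≢0 s (r ∸ s) {{ℕ.>-nonZero 1≤s}} {{ℕ.>-nonZero (ℕ.m<n⇒0<n∸m s<r)}}}}
    {{ℕ.>-nonZero (ℕ.m<n⇒0<n∸m (ℕ.<-≤-trans s<r (ℕ.m≤m+n r _)))}}
  where
  s<r : s ℕ.< r
  s<r = ℕ.≤-<-trans (ℕ.m≤m+n s _) 2s<r

module _ (r s : ℕ) .{{nz : NonZero (Δ₂ r s)}} where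

  private
    R S : ℤ
    R = + r
    S = + s

    -- x ↦ x / (2 Δ₂)
    over-2Δ₂ : ℤ → ℚ
    over-2Δ₂ x = _/_ x (2 ℕ.* Δ₂ r s) {{ℕ.m*n≢0 2 (Δ₂ r s)}}

  P₂ : ℕ → ℚ
  P₂ n = over-2Δ₂
    (- 1ℤ + (+ n) ^ 2 + + 3 * R + + n * (+ 3 * R - S) - S)

  Cᵘ : ℚ
  Cᵘ = over-2Δ₂
    ( R ^ 3 * (+ 4 * S ^ 2 - + 2 * S)
    + R ^ 2 * (- (+ 10 * S ^ 3) + + 3 * S ^ 2 + + 4 * S)
    + R * (+ 8 * S ^ 4 - S ^ 3 - + 6 * S ^ 2 - + 2 * S - + 2)
    - + 2 * S ^ 5 + + 2 * S ^ 3 + + 2 * S ^ 2 + S + 1ℤ )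

  Cᵈ : ℚ
  Cᵈ = over-2Δ₂
    ( R ^ 3 * (- (+ 4 * S ^ 2) - + 2 * S)
    + R ^ 2 * (+ 10 * S ^ 3 + + 3 * S ^ 2)
    + R * (- (+ 8 * S ^ 4) - S ^ 3 + + 2 * S - + 2)
    + + 2 * S ^ 5 - + 2 * S ^ 2 + S + 1ℤ )

{-# OPTIONS --safe #-}
module Submission where

open import Defs
open import Algebra.Bundles using (module AbelianGroup)
open import Data.Empty using (⊥; ⊥-elim)
open import Data.Fin.Base using (toℕ)
open import Data.Integer.Base as ℤ using (ℤ; +_; -[1+_]; 0ℤ; 1ℤ; -1ℤ)
open import Data.Integer.DivMod using (_/ℕ_; _%ℕ_; n%ℕd<d; a≡a%ℕn+[a/ℕn]*n)
import Data.Integer.Properties as ℤ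
open import Data.Integer.Tactic.RingSolver using (solve-∀)
open import Data.Nat.Base as ℕ using (ℕ; zero; suc; s≤s; z≤n; z<s; NonZero; _∸_)
open import Data.Nat.Coprimality using (Coprime; coprime-divisor; coprime-Bézout)
open import Data.Nat.Divisibility
  using (_∣_; _∤_; divides; ∣⇒≤; ∣-refl; ∣m∣n⇒∣m+n; _∣0)
open import Data.Nat.GCD using (module Bézout)
open import Data.Nat.Induction using (<-rec)
import Data.Nat.Properties as ℕ
import Data.Nat.Tactic.RingSolver as ℕ-Solver
open import Data.Product.Base using (_×_; _,_; ∃; ∃₂; proj₁; proj₂)
open import Data.Rational.Base as ℚ using (_/_)
import Data.Rational.Properties as ℚ
import Data.Rational.Unnormalised.Base as ℚᵘ
import Data.Rational.Unnormalised.Properties as ℚᵘ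
open import Data.Sum.Base using (_⊎_; inj₁; inj₂)
open import Function.Base using (_∘_)
open import Relation.Binary.PropositionalEquality
open import Algebra.Properties.CommutativeMonoid.Sum ℤ.+-0-commutativeMonoid
  using (sum-cong-≗)
open import Algebra.Properties.Group (AbelianGroup.group ℤ.+-0-abelianGroup)
  using () renaming (∙-cancelˡ to +-cancelˡ)

-- Put a = s, b = r − s and c = 2r − s, so that c = a + 2b.  If
-- n = b u + a v + a b k with 0 ≤ u < a and 0 ≤ v < b, then n has k + 1
-- representations by a and b (Popoviciu).  Passing from n to n − c lowers v
-- by 1 modulo b and u by 2 modulo the odd number a, so the sums of u and v
-- along a progression of difference c telescope: there are explicit
-- functions Ψ of u and Φ of v for which
--   2 (2abc p(n) − n² − n (a + b + c)) + b c Ψ(u) + 2 a c Φ(v)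
-- does not change under n ↦ n − c.  For n < c its value is explicit, and
-- crude bounds on Ψ and Φ suffice.
module Counting where

  open import Data.Integer.Base using (_+_; _-_; _*_; -_; _^_)

  shift : ℕ → Series → Series
  shift zero    f n       = f n
  shift (suc k) f zero    = 0ℤ
  shift (suc k) f (suc n) = shift k f n

  -- Multiplication by 1 − q^k.
  δ : ℕ → Series → Series
  δ k f = f ⊖ shift k f

  shift-cong : ∀ k {f g} → f ≗ g → shift k f ≗ shift k g
  shift-cong zero    f≗g n       = f≗g n
  shift-cong (suc k) f≗g zero    = refl
  shift-cong (suc k) f≗g (suc n) = shift-cong k f≗g n

  δ-cong : ∀ k {f g} → f ≗ g → δ k f ≗ δ k g
  δ-cong k f≗g n = cong₂ _-_ (f≗g n) (shift-cong k f≗g n)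

  shift-+ : ∀ k f n → shift k f (k ℕ.+ n) ≡ f n
  shift-+ zero    f n = refl
  shift-+ (suc k) f n = shift-+ k f n

  shift-< : ∀ {k} f {n} → n ℕ.< k → shift k f n ≡ 0ℤ
  shift-< {suc k} f {zero}  _         = refl
  shift-< {suc k} f {suc n} (s≤s n<k) = shift-< f n<k

  shift-⊖ : ∀ k f g → shift k (f ⊖ g) ≗ shift k f ⊖ shift k g
  shift-⊖ zero    f g n       = refl
  shift-⊖ (suc k) f g zero    = refl
  shift-⊖ (suc k) f g (suc n) = shift-⊖ k f g n

  shift-shift : ∀ j k f → shift j (shift k f) ≗ shift (j ℕ.+ k) f
  shift-shift zero    k f n       = refl
  shift-shift (suc j) k f zero    = refl
  shift-shift (suc j) k f (suc n) = shift-shift j k f n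

  shift-comm : ∀ j k f → shift j (shift k f) ≗ shift k (shift j f)
  shift-comm j k f n = trans (shift-shift j k f n)
    (trans (cong (λ i → shift i f n) (ℕ.+-comm j k)) (sym (shift-shift k j f n)))

  δ-comm : ∀ j k f → δ j (δ k f) ≗ δ k (δ j f)
  δ-comm j k f n = begin
    (f n - shift k f n) - shift j (δ k f) n
      ≡⟨ cong (_-_ (f n - shift k f n)) (shift-⊖ j f (shift k f) n) ⟩
    (f n - shift k f n) - (shift j f n - shift j (shift k f) n)
      ≡⟨ exchange (f n) (shift k f n) (shift j f n) _ ⟩
    (f n - shift j f n) - (shift k f n - shift j (shift k f) n)
      ≡⟨ cong (λ x → f n - shift j f n - (shift k f n - x)) (shift-comm j k f n) ⟩
    (f n - shift j f n) - (shift k f n - shift k (shift j f) n)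
      ≡⟨ cong (_-_ (f n - shift j f n)) (shift-⊖ k f (shift j f) n) ⟨
    (f n - shift j f n) - shift k (δ j f) n ∎
    where
    open ≡-Reasoning
    exchange : ∀ w x y z → (w - x) - (y - z) ≡ (w - y) - (x - z)
    exchange = solve-∀

  ⊛-congˡ : ∀ f {g h} → g ≗ h → f ⊛ g ≗ f ⊛ h
  ⊛-congˡ f g≗h n = sum-cong-≗ {suc n} λ i → cong (f (toℕ i) *_) (g≗h (n ℕ.∸ toℕ i))

  ⊛-distribˡ-⊖ : ∀ f g h → f ⊛ (g ⊖ h) ≗ (f ⊛ g) ⊖ (f ⊛ h)
  ⊛-distribˡ-⊖ f g h zero = lemma (f 0) (g 0) (h 0)
    where
    lemma : ∀ x y z → x * (y - z) + 0ℤ ≡ (x * y + 0ℤ) - (x * z + 0ℤ)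
    lemma = solve-∀
  ⊛-distribˡ-⊖ f g h (suc n) = trans
    (cong (_+_ (f 0 * (g (suc n) - h (suc n)))) (⊛-distribˡ-⊖ (f ∘ suc) g h n))
    (lemma (f 0) (g (suc n)) (h (suc n)) _ _)
    where
    lemma : ∀ x y z v w → x * (y - z) + (v - w) ≡ (x * y + v) - (x * z + w)
    lemma = solve-∀

  ⊛-identityʳ : ∀ f → f ⊛ 𝟙 ≗ f
  ⊛-identityʳ f zero = lemma (f 0)
    where
    lemma : ∀ x → x * 1ℤ + 0ℤ ≡ x
    lemma = solve-∀
  ⊛-identityʳ f (suc n) = trans
    (cong₂ _+_ (ℤ.*-zeroʳ (f 0)) (⊛-identityʳ (f ∘ suc) n)) (ℤ.+-identityˡ _)

  ⊛-shift₁ : ∀ f g → f ⊛ shift 1 g ≗ shift 1 (f ⊛ g)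
  ⊛-shift₁ f g zero          = trans (ℤ.+-identityʳ _) (ℤ.*-zeroʳ (f 0))
  ⊛-shift₁ f g (suc zero)    = cong (_+_ (f 0 * g 0)) (⊛-shift₁ (f ∘ suc) g 0)
  ⊛-shift₁ f g (suc (suc n)) =
    cong (_+_ (f 0 * g (suc n))) (⊛-shift₁ (f ∘ suc) g (suc n))

  ⊛-shift : ∀ k f g → f ⊛ shift k g ≗ shift k (f ⊛ g)
  ⊛-shift zero    f g n = refl
  ⊛-shift (suc k) f g n = begin
    (f ⊛ shift (suc k) g) n       ≡⟨ ⊛-congˡ f (λ m → sym (shift-shift 1 k g m)) n ⟩
    (f ⊛ shift 1 (shift k g)) n   ≡⟨ ⊛-shift₁ f (shift k g) n ⟩
    shift 1 (f ⊛ shift k g) n     ≡⟨ shift-cong 1 (⊛-shift k f g) n ⟩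
    shift 1 (shift k (f ⊛ g)) n   ≡⟨ shift-shift 1 k (f ⊛ g) n ⟩
    shift (suc k) (f ⊛ g) n       ∎
    where open ≡-Reasoning

  ⊛-δ : ∀ k f g → f ⊛ δ k g ≗ δ k (f ⊛ g)
  ⊛-δ k f g n = trans (⊛-distribˡ-⊖ f g (shift k g) n)
    (cong (_-_ ((f ⊛ g) n)) (⊛-shift k f g n))

  q^-shift : ∀ k → q^ k ≗ shift k 𝟙
  q^-shift zero    n       = refl
  q^-shift (suc k) zero    = refl
  q^-shift (suc k) (suc n) = q^-shift k n

  ⊛-1-q^ : ∀ k f → f ⊛ (𝟙 ⊖ q^ k) ≗ δ k f
  ⊛-1-q^ k f n = begin
    (f ⊛ (𝟙 ⊖ q^ k)) n ≡⟨ ⊛-congˡ f (λ m → cong (_-_ (𝟙 m)) (q^-shift k m)) n ⟩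
    (f ⊛ δ k 𝟙) n      ≡⟨ ⊛-δ k f 𝟙 n ⟩
    δ k (f ⊛ 𝟙) n      ≡⟨ δ-cong k (⊛-identityʳ f) n ⟩
    δ k f n            ∎
    where open ≡-Reasoning

  reciprocal⇒δ : ∀ a b c p →
    p ⊛ ((𝟙 ⊖ q^ a) ⊛ (𝟙 ⊖ q^ b) ⊛ (𝟙 ⊖ q^ c)) ≗ 𝟙 → δ a (δ b (δ c p)) ≗ 𝟙
  reciprocal⇒δ a b c p p-inv n = begin
    δ a (δ b (δ c p)) n               ≡⟨ δ-cong a (δ-comm b c p) n ⟩
    δ a (δ c (δ b p)) n               ≡⟨ δ-comm a c (δ b p) n ⟩
    δ c (δ a (δ b p)) n               ≡⟨ δ-cong c (δ-comm a b p) n ⟩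
    δ c (δ b (δ a p)) n               ≡⟨ δ-cong c (δ-cong b (⊛-1-q^ a p)) n ⟨
    δ c (δ b (p ⊛ A)) n               ≡⟨ δ-cong c (⊛-δ b p A) n ⟨
    δ c (p ⊛ δ b A) n                 ≡⟨ ⊛-δ c p (δ b A) n ⟨
    (p ⊛ δ c (δ b A)) n               ≡⟨ ⊛-congˡ p (δ-cong c (⊛-1-q^ b A)) n ⟨
    (p ⊛ δ c (A ⊛ (𝟙 ⊖ q^ b))) n      ≡⟨ ⊛-congˡ p (⊛-1-q^ c (A ⊛ (𝟙 ⊖ q^ b))) n ⟨
    (p ⊛ (A ⊛ (𝟙 ⊖ q^ b) ⊛ (𝟙 ⊖ q^ c))) n ≡⟨ p-inv n ⟩
    𝟙 n                               ∎
    where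
    open ≡-Reasoning
    A = 𝟙 ⊖ q^ a

  stride-induction : ∀ k .{{_ : NonZero k}} (P : ℕ → Set) →
    (∀ n → n ℕ.< k → P n) → (∀ n → P n → P (k ℕ.+ n)) → ∀ n → P n
  stride-induction k P base step = <-rec P λ n rec → go n rec (ℕ.<-≤-connex n k)
    where
    go : ∀ n → (∀ {m} → m ℕ.< n → P m) → n ℕ.< k ⊎ k ℕ.≤ n → P n
    go n rec (inj₁ n<k) = base n n<k
    go n rec (inj₂ k≤n) with ℕ.m≤n⇒∃[o]m+o≡n k≤n
    ... | m , refl = step m (rec (ℕ.m<n+m m (ℕ.>-nonZero⁻¹ k)))

  δ-base : ∀ {k} f {g n} → δ k f ≗ g → n ℕ.< k → f n ≡ g n
  δ-base {k} f {g} {n} δf≗g n<k = begin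
    f n                ≡⟨ ℤ.+-identityʳ (f n) ⟨
    f n - 0ℤ           ≡⟨ cong (_-_ (f n)) (shift-< f n<k) ⟨
    f n - shift k f n  ≡⟨ δf≗g n ⟩
    g n                ∎
    where open ≡-Reasoning

  δ-step : ∀ {k} f {g} → δ k f ≗ g → ∀ n → f (k ℕ.+ n) ≡ f n + g (k ℕ.+ n)
  δ-step {k} f {g} δf≗g n = begin
    f (k ℕ.+ n)                                         ≡⟨ lemma (f (k ℕ.+ n)) (f n) ⟩
    f n + (f (k ℕ.+ n) - f n)                           ≡⟨ cong (λ x → f n + (f (k ℕ.+ n) - x)) (shift-+ k f n) ⟨
    f n + (f (k ℕ.+ n) - shift k f (k ℕ.+ n))           ≡⟨ cong (_+_ (f n)) (δf≗g (k ℕ.+ n)) ⟩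
    f n + g (k ℕ.+ n)                                   ∎
    where
    open ≡-Reasoning
    lemma : ∀ x y → x ≡ y + (x - y)
    lemma = solve-∀

  module _ {a} .{{a≢0 : NonZero a}} (g : Series) (δg≗𝟙 : δ a g ≗ 𝟙) where

    private
      𝟙-pos : ∀ {n} → 0 ℕ.< n → 𝟙 n ≡ 0ℤ
      𝟙-pos {suc n} _ = refl

      periodic : ∀ n → g (a ℕ.+ n) ≡ g n
      periodic n = trans (δ-step g δg≗𝟙 n) (trans
        (cong (_+_ (g n)) (𝟙-pos (ℕ.<-≤-trans (ℕ.>-nonZero⁻¹ a) (ℕ.m≤m+n a n))))
        (ℤ.+-identityʳ (g n)))

    geometric-∣ : ∀ {n} → a ∣ n → g n ≡ 1ℤ
    geometric-∣ (divides q refl) = go q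
      where
      go : ∀ q → g (q ℕ.* a) ≡ 1ℤ
      go zero    = δ-base g δg≗𝟙 (ℕ.>-nonZero⁻¹ a)
      go (suc q) = trans (periodic (q ℕ.* a)) (go q)

    geometric-∤ : ∀ n → a ∤ n → g n ≡ 0ℤ
    geometric-∤ = stride-induction a (λ n → a ∤ n → g n ≡ 0ℤ) base step
      where
      base : ∀ n → n ℕ.< a → a ∤ n → g n ≡ 0ℤ
      base zero    _   a∤n = ⊥-elim (a∤n (a ∣0))
      base (suc n) n<a a∤n = δ-base g δg≗𝟙 n<a
      step : ∀ n → (a ∤ n → g n ≡ 0ℤ) → a ∤ a ℕ.+ n → g (a ℕ.+ n) ≡ 0ℤ
      step n ih a∤a+n =
        trans (periodic n) (ih λ a∣n → a∤a+n (∣m∣n⇒∣m+n ∣-refl a∣n))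

  NonNeg : ℤ → Set
  NonNeg x = 0ℤ ℤ.≤ x

  infixl 6 _⊹_
  infixl 7 _⊠_

  _⊹_ : ∀ {x y} → NonNeg x → NonNeg y → NonNeg (x + y)
  _⊹_ = ℤ.+-mono-≤

  _⊠_ : ∀ {x y} → NonNeg x → NonNeg y → NonNeg (x * y)
  _⊠_ {+ m} {+ n} _ _ = subst NonNeg (ℤ.pos-* m n) (ℤ.+≤+ z≤n)

  nat : ∀ n → NonNeg (+ n)
  nat n = ℤ.+≤+ z≤n

  square : ∀ x → NonNeg (x * x)
  square (+ zero)  = ℤ.+≤+ z≤n
  square (+ suc n) = ℤ.+≤+ z≤n
  square -[1+ n ]  = ℤ.+≤+ z≤n

  gap : ∀ {m n} → m ℕ.< n → NonNeg (+ n - (1ℤ + + m))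
  gap m<n = ℤ.i≤j⇒0≤j-i (ℤ.+≤+ m<n)

  -1-negative : ∀ {x} → NonNeg x → x ≡ -1ℤ → ⊥
  -1-negative () refl

  module Denumerant (a b : ℕ) .{{a≢0 : NonZero a}} .{{b≢0 : NonZero b}}
    (a⊥b : Coprime a b) where

    private
      A B : ℤ
      A = + a
      B = + b

    Rep : ℕ → ℕ → ℕ → ℤ → Set
    Rep n u v k = u ℕ.< a × v ℕ.< b × + n ≡ B * + u + A * + v + A * B * k

    0<A : NonNeg (A - 1ℤ)
    0<A = gap (ℕ.>-nonZero⁻¹ a)

    private
      Bézoutℤ : ∃₂ λ X Y → 1ℤ ≡ B * X + A * Y
      Bézoutℤ with coprime-Bézout a⊥b
      ... | Bézout.+- x y eq = - + y , + x , lemma (cast eq)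
        where
        cast : 1 ℕ.+ y ℕ.* b ≡ x ℕ.* a → 1ℤ + + y * B ≡ + x * A
        cast e = trans (cong (_+_ 1ℤ) (sym (ℤ.pos-* y b))) (trans (cong +_ e) (ℤ.pos-* x a))
        lemma : 1ℤ + + y * B ≡ + x * A → 1ℤ ≡ B * - + y + A * + x
        lemma e = trans (ring₁ B (+ y)) (trans (cong (_+_ (B * - + y)) e) (ring₂ A B (+ x) (+ y)))
          where
          ring₁ : ∀ b y → 1ℤ ≡ b * - y + (1ℤ + y * b)
          ring₁ = solve-∀
          ring₂ : ∀ a b x y → b * - y + x * a ≡ b * - y + a * x
          ring₂ = solve-∀
      ... | Bézout.-+ x y eq = + y , - + x , lemma (cast eq)
        where
        cast : 1 ℕ.+ x ℕ.* a ≡ y ℕ.* b → 1ℤ + + x * A ≡ + y * B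
        cast e = trans (cong (_+_ 1ℤ) (sym (ℤ.pos-* x a))) (trans (cong +_ e) (ℤ.pos-* y b))
        lemma : 1ℤ + + x * A ≡ + y * B → 1ℤ ≡ B * + y + A * - + x
        lemma e = trans (ring₁ A (+ x)) (trans (cong (_- A * + x) e) (ring₂ A B (+ x) (+ y)))
          where
          ring₁ : ∀ a x → 1ℤ ≡ (1ℤ + x * a) - a * x
          ring₁ = solve-∀
          ring₂ : ∀ a b x y → y * b - a * x ≡ b * y + a * - x
          ring₂ = solve-∀

    represent : ∀ n → ∃₂ λ u v → ∃ λ k → Rep n u v k
    represent n with Bézoutℤ
    ... | X , Y , eq = U %ℕ a , V %ℕ b , U /ℕ a + V /ℕ b , n%ℕd<d U a , n%ℕd<d V b , (begin
      + n                        ≡⟨ ℤ.*-identityʳ (+ n) ⟨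
      + n * 1ℤ                   ≡⟨ cong (+ n *_) eq ⟩
      + n * (B * X + A * Y)      ≡⟨ ring₁ A B (+ n) X Y ⟩
      B * U + A * V              ≡⟨ cong₂ (λ s t → B * s + A * t) (a≡a%ℕn+[a/ℕn]*n U a) (a≡a%ℕn+[a/ℕn]*n V b) ⟩
      B * (+ (U %ℕ a) + U /ℕ a * A) + A * (+ (V %ℕ b) + V /ℕ b * B)
                                 ≡⟨ ring₂ A B (+ (U %ℕ a)) (U /ℕ a) (+ (V %ℕ b)) (V /ℕ b) ⟩
      B * + (U %ℕ a) + A * + (V %ℕ b) + A * B * (U /ℕ a + V /ℕ b) ∎)
      where
      open ≡-Reasoning
      U V : ℤ
      U = + n * X
      V = + n * Y
      ring₁ : ∀ a b n x y → n * (b * x + a * y) ≡ b * (n * x) + a * (n * y)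
      ring₁ = solve-∀
      ring₂ : ∀ a b u q v r → b * (u + q * a) + a * (v + r * b) ≡ b * u + a * v + a * b * (q + r)
      ring₂ = solve-∀

    private
      ∣-fromℤ : ∀ {m n z} → + n ≡ + m * z → m ∣ n
      ∣-fromℤ {m} {n} {z} eq = divides ℤ.∣ z ∣
        (trans (cong ℤ.∣_∣ eq) (trans (ℤ.abs-* (+ m) z) (ℕ.*-comm m ℤ.∣ z ∣)))

      rep-∣ : ∀ {n v k} → Rep n 0 v k → a ∣ n
      rep-∣ {n} {v} {k} (_ , _ , eq) = ∣-fromℤ {z = + v + B * k} (trans eq (lemma A B (+ v) k))
        where
        lemma : ∀ a b v k → b * 0ℤ + a * v + a * b * k ≡ a * (v + b * k)
        lemma = solve-∀

      rep-∤ : ∀ {n u v k} → Rep n (suc u) v k → a ∤ n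
      rep-∤ {n} {u} {v} {k} (u<a , _ , eq) (divides q refl) = ℕ.<⇒≱ u<a (∣⇒≤ (coprime-divisor a⊥b
        (∣-fromℤ {z = + q - + v - B * k} (begin
          + (b ℕ.* suc u)                                           ≡⟨ ℤ.pos-* b (suc u) ⟩
          B * + suc u                                               ≡⟨ ring₁ A B (+ suc u) (+ v) k ⟩
          (B * + suc u + A * + v + A * B * k) - A * + v - A * B * k ≡⟨ cong (λ x → x - A * + v - A * B * k) (trans (sym eq) (ℤ.pos-* q a)) ⟩
          + q * A - A * + v - A * B * k                             ≡⟨ ring₂ A B (+ q) (+ v) k ⟩
          A * (+ q - + v - B * k)                                   ∎))))
        where
        open ≡-Reasoning
        ring₁ : ∀ a b u v k → b * u ≡ (b * u + a * v + a * b * k) - a * v - a * b * k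
        ring₁ = solve-∀
        ring₂ : ∀ a b q v k → q * a - a * v - a * b * k ≡ a * (q - v - b * k)
        ring₂ = solve-∀

      -- For any other k a sum of nonnegative terms equals −1.
      small-∣ : ∀ {n v k} → n ℕ.< b → Rep n 0 v k → k ≡ 0ℤ
      small-∣ {k = + zero} _ _ = refl
      small-∣ {n} {v} {+ suc j} n<b (_ , _ , eq) = ⊥-elim (-1-negative
        (gap n<b ⊹ nat a ⊠ nat v ⊹ 0<A ⊠ nat b ⊹ nat a ⊠ nat b ⊠ nat j)
        (trans (cong (λ x → B - (1ℤ + x) + A * + v + (A - 1ℤ) * B + A * B * + j) eq)
          (lemma A B (+ v) (+ j))))
        where
        lemma : ∀ a b v j → b - (1ℤ + (b * 0ℤ + a * v + a * b * (1ℤ + j)))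
          + a * v + (a - 1ℤ) * b + a * b * j ≡ -1ℤ
        lemma = solve-∀
      small-∣ {n} {v} { -[1+ j ]} n<b (_ , v<b , eq) = ⊥-elim (-1-negative
        (nat n ⊹ nat a ⊠ gap v<b ⊹ 0<A ⊹ nat a ⊠ nat b ⊠ nat j)
        (trans (cong (λ x → x + A * (B - (1ℤ + + v)) + (A - 1ℤ) + A * B * + j) eq)
          (lemma A B (+ v) (+ j))))
        where
        lemma : ∀ a b v j → b * 0ℤ + a * v + a * b * (- (1ℤ + j))
          + a * (b - (1ℤ + v)) + (a - 1ℤ) + a * b * j ≡ -1ℤ
        lemma = solve-∀

      small-∤ : ∀ {n u v k} → n ℕ.< b → Rep n (suc u) v k → k ≡ -1ℤ
      small-∤ {k = -[1+ zero ]} _ _ = refl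
      small-∤ {n} {u} {v} {+ j} n<b (_ , _ , eq) = ⊥-elim (-1-negative
        (gap n<b ⊹ nat b ⊠ nat u ⊹ nat a ⊠ nat v ⊹ nat a ⊠ nat b ⊠ nat j)
        (trans (cong (λ x → B - (1ℤ + x) + B * + u + A * + v + A * B * + j) eq)
          (lemma A B (+ u) (+ v) (+ j))))
        where
        lemma : ∀ a b u v j → b - (1ℤ + (b * (1ℤ + u) + a * v + a * b * j))
          + b * u + a * v + a * b * j ≡ -1ℤ
        lemma = solve-∀
      small-∤ {n} {u} {v} { -[1+ suc j ]} n<b (u<a , v<b , eq) = ⊥-elim (-1-negative
        (nat n ⊹ nat b ⊠ gap u<a ⊹ nat a ⊠ gap v<b ⊹ 0<A ⊹ nat b ⊹ nat a ⊠ nat b ⊠ nat j)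
        (trans (cong (λ x → x + B * (A - (1ℤ + (1ℤ + + u))) + A * (B - (1ℤ + + v))
            + (A - 1ℤ) + B + A * B * + j) eq)
          (lemma A B (+ u) (+ v) (+ j))))
        where
        lemma : ∀ a b u v j → b * (1ℤ + u) + a * v + a * b * (- (1ℤ + (1ℤ + j)))
          + b * (a - (1ℤ + (1ℤ + u))) + a * (b - (1ℤ + v)) + (a - 1ℤ) + b + a * b * j ≡ -1ℤ
        lemma = solve-∀

    denumerant : ∀ {g h : Series} → δ a g ≗ 𝟙 → δ b h ≗ g →
      ∀ n u v k → Rep n u v k → h n ≡ k + 1ℤ
    denumerant {g} {h} δg≗𝟙 δh≗g = stride-induction b
      (λ n → ∀ u v k → Rep n u v k → h n ≡ k + 1ℤ) base step
      where
      base : ∀ n → n ℕ.< b → ∀ u v k → Rep n u v k → h n ≡ k + 1ℤ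
      base n n<b zero v k rep = trans (δ-base h δh≗g n<b)
        (trans (geometric-∣ g δg≗𝟙 (rep-∣ {k = k} rep)) (cong (_+ 1ℤ) (sym (small-∣ {k = k} n<b rep))))
      base n n<b (suc u) v k rep = trans (δ-base h δh≗g n<b)
        (trans (geometric-∤ g δg≗𝟙 n (rep-∤ {k = k} rep)) (cong (_+ 1ℤ) (sym (small-∤ {k = k} n<b rep))))

      step : ∀ n → (∀ u v k → Rep n u v k → h n ≡ k + 1ℤ) →
        ∀ u v k → Rep (b ℕ.+ n) u v k → h (b ℕ.+ n) ≡ k + 1ℤ
      step n ih zero v k rep@(0<a , v<b , eq) = trans (δ-step h δh≗g n) (trans
        (cong₂ _+_ (ih (ℕ.pred a) v (k - 1ℤ)
          ( ℕ.≤-reflexive a≡ , v<b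
          , +-cancelˡ B _ _ (trans eq (trans (ring₁ A B (+ v) k)
              (cong (λ x → B + (B * (x - 1ℤ) + A * + v + A * B * (k - 1ℤ))) (cong +_ (sym a≡)))))))
          (geometric-∣ g δg≗𝟙 (rep-∣ {k = k} rep)))
        (ring₂ k))
        where
        a≡ : suc (ℕ.pred a) ≡ a
        a≡ = ℕ.suc-pred a
        ring₁ : ∀ a b v k → b * 0ℤ + a * v + a * b * k ≡ b + (b * (a - 1ℤ) + a * v + a * b * (k - 1ℤ))
        ring₁ = solve-∀
        ring₂ : ∀ k → k - 1ℤ + 1ℤ + 1ℤ ≡ k + 1ℤ
        ring₂ = solve-∀
      step n ih (suc u) v k rep@(u<a , v<b , eq) = trans (δ-step h δh≗g n) (trans
        (cong₂ _+_ (ih u v k (ℕ.<-trans (ℕ.n<1+n u) u<a , v<b ,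
            +-cancelˡ B _ _ (trans eq (ring A B (+ u) (+ v) k))))
          (geometric-∤ g δg≗𝟙 (b ℕ.+ n) (rep-∤ {k = k} rep)))
        (ℤ.+-identityʳ (k + 1ℤ)))
        where
        ring : ∀ a b u v k → b * (1ℤ + u) + a * v + a * b * k ≡ b + (b * u + a * v + a * b * k)
        ring = solve-∀

  parity : ℕ → ℤ
  parity 0             = 0ℤ
  parity 1             = 1ℤ
  parity (suc (suc n)) = parity n

  parity-suc : ∀ n → parity (suc n) ≡ 1ℤ - parity n
  parity-suc 0             = refl
  parity-suc 1             = refl
  parity-suc (suc (suc n)) = parity-suc n

  parity-split : ∀ n → parity n ≡ 0ℤ ⊎ parity n ≡ 1ℤ
  parity-split 0             = inj₁ refl
  parity-split 1             = inj₂ refl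
  parity-split (suc (suc n)) = parity-split n

  -- Ψ a and Φ b are solutions, as functions on ℤ/a and ℤ/b, of
  --   Ψ(u) − Ψ(u − 2) = 2 (2u − (a − 1)),   Φ(v) − Φ(v − 1) = 2v − (b − 1).
  -- The right-hand sides have mean zero; the parity term makes Ψ consistent
  -- when u − 2 wraps around the odd modulus a.
  Ψ : ℕ → ℕ → ℤ
  Ψ a u = + u * (+ u + + 3 - + a) + + a * parity u

  Φ : ℕ → ℕ → ℤ
  Φ b v = + v * (+ v + + 2 - + b)

  Ψ-step : ∀ a u → parity a ≡ 1ℤ → u ℕ.< a → ∃₂ λ u′ j → u′ ℕ.< a ×
    + u - + 2 ≡ + u′ - + a * j ×
    Ψ a u ≡ Ψ a u′ + (+ 4 * + u - + 2 * (+ a - 1ℤ))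
  Ψ-step 1 0 _ _ = 0 , + 2 , z<s , refl , refl
  Ψ-step (suc (suc a)) 0 odd _ =
    a , 1ℤ , ℕ.m<n+m a z<s , ring₁ (+ a) ,
    trans (ring₂ (+ a)) (cong (λ e → + a * (+ a + + 3 - A) + A * e + (+ 4 * 0ℤ - + 2 * (A - 1ℤ))) (sym odd))
    where
    A = + suc (suc a)
    ring₁ : ∀ x → 0ℤ - + 2 ≡ x - (+ 2 + x) * 1ℤ
    ring₁ = solve-∀
    ring₂ : ∀ x → let a = + 2 + x in 0ℤ * (0ℤ + + 3 - a) + a * 0ℤ ≡
      x * (x + + 3 - a) + a * 1ℤ + (+ 4 * 0ℤ - + 2 * (a - 1ℤ))
    ring₂ = solve-∀
  Ψ-step 1 1 _ (s≤s ())
  Ψ-step (suc (suc a)) 1 odd _ =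
    suc a , 1ℤ , ℕ.n<1+n (suc a) , ring₁ (+ a) ,
    trans (ring₂ (+ a)) (cong (λ e → + suc a * (+ suc a + + 3 - A) + A * e + (+ 4 * 1ℤ - + 2 * (A - 1ℤ)))
      (sym (trans (parity-suc a) (cong (_-_ 1ℤ) odd))))
    where
    A = + suc (suc a)
    ring₁ : ∀ x → 1ℤ - + 2 ≡ (1ℤ + x) - (+ 2 + x) * 1ℤ
    ring₁ = solve-∀
    ring₂ : ∀ x → let a = + 2 + x in 1ℤ * (1ℤ + + 3 - a) + a * 1ℤ ≡
      (1ℤ + x) * (1ℤ + x + + 3 - a) + a * 0ℤ + (+ 4 * 1ℤ - + 2 * (a - 1ℤ))
    ring₂ = solve-∀
  Ψ-step a (suc (suc u)) _ u<a =
    u , 0ℤ , ℕ.<-trans (ℕ.m<n+m u z<s) u<a , ring₁ (+ a) (+ u) , ring₂ (+ a) (+ u) (parity u)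
    where
    ring₁ : ∀ a u → (+ 2 + u) - + 2 ≡ u - a * 0ℤ
    ring₁ = solve-∀
    ring₂ : ∀ a u e → (+ 2 + u) * (+ 2 + u + + 3 - a) + a * e ≡
      u * (u + + 3 - a) + a * e + (+ 4 * (+ 2 + u) - + 2 * (a - 1ℤ))
    ring₂ = solve-∀

  Φ-step : ∀ b v → v ℕ.< b → ∃₂ λ v′ j → v′ ℕ.< b ×
    + v - 1ℤ ≡ + v′ - + b * j ×
    Φ b v ≡ Φ b v′ + (+ 2 * + v - (+ b - 1ℤ))
  Φ-step (suc b) 0 _ = b , 1ℤ , ℕ.n<1+n b , ring₁ (+ b) , ring₂ (+ b)
    where
    ring₁ : ∀ x → 0ℤ - 1ℤ ≡ x - (1ℤ + x) * 1ℤ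
    ring₁ = solve-∀
    ring₂ : ∀ x → let b = 1ℤ + x in 0ℤ * (0ℤ + + 2 - b) ≡ x * (x + + 2 - b) + (+ 2 * 0ℤ - (b - 1ℤ))
    ring₂ = solve-∀
  Φ-step b (suc v) v<b =
    v , 0ℤ , ℕ.<-trans (ℕ.n<1+n v) v<b , ring₁ (+ b) (+ v) , ring₂ (+ b) (+ v)
    where
    ring₁ : ∀ b v → (1ℤ + v) - 1ℤ ≡ v - b * 0ℤ
    ring₁ = solve-∀
    ring₂ : ∀ b v → (1ℤ + v) * (1ℤ + v + + 2 - b) ≡ v * (v + + 2 - b) + (+ 2 * (1ℤ + v) - (b - 1ℤ))
    ring₂ = solve-∀

  NonNeg-resp : ∀ {x y} → x ≡ y → NonNeg y → NonNeg x
  NonNeg-resp refl y≥0 = y≥0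

  parity≥0 : ∀ n → NonNeg (parity n)
  parity≥0 n with parity-split n
  ... | inj₁ e = NonNeg-resp e (nat 0)
  ... | inj₂ e = NonNeg-resp e (nat 1)

  parity≤1 : ∀ n → NonNeg (1ℤ - parity n)
  parity≤1 n with parity-split n
  ... | inj₁ e = NonNeg-resp (cong (_-_ 1ℤ) e) (nat 1)
  ... | inj₂ e = NonNeg-resp (cong (_-_ 1ℤ) e) (nat 0)

  module _ {a u} (u<a : u ℕ.< a) where
    private
      A U E : ℤ
      A = + a
      U = + u
      E = parity u

      0<A : NonNeg (A - 1ℤ)
      0<A = gap (ℕ.≤-<-trans z≤n u<a)

    Ψ-lower : NonNeg (Ψ a u + (A - 1ℤ) * (A - 1ℤ))
    Ψ-lower = NonNeg-resp (ring A U E)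
      (square (A - 1ℤ - U) ⊹ nat u ⊠ 0<A ⊹ nat 2 ⊠ nat u ⊹ nat a ⊠ parity≥0 u)
      where
      ring : ∀ a u e → u * (u + + 3 - a) + a * e + (a - 1ℤ) * (a - 1ℤ) ≡
        (a - 1ℤ - u) * (a - 1ℤ - u) + u * (a - 1ℤ) + + 2 * u + a * e
      ring = solve-∀

    Ψ-upper : NonNeg (+ 4 * A - Ψ a u)
    Ψ-upper = NonNeg-resp (ring A U E)
      (nat a ⊠ parity≤1 u ⊹ nat (3 ℕ.+ u) ⊠ (gap u<a ⊹ nat 1))
      where
      ring : ∀ a u e → + 4 * a - (u * (u + + 3 - a) + a * e) ≡
        a * (1ℤ - e) + (+ 3 + u) * (a - (1ℤ + u) + 1ℤ)
      ring = solve-∀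

    Ψ-4u-lower : NonNeg (Ψ a u - + 4 * U + A * A)
    Ψ-4u-lower = NonNeg-resp (ring A U E) (square (A - U) ⊹ nat u ⊠ 0<A ⊹ nat a ⊠ parity≥0 u)
      where
      ring : ∀ a u e → u * (u + + 3 - a) + a * e - + 4 * u + a * a ≡
        (a - u) * (a - u) + u * (a - 1ℤ) + a * e
      ring = solve-∀

  Ψ-4u-upper : ∀ {a} u → u ℕ.< a → NonNeg (+ 4 * + u - Ψ a u)
  Ψ-4u-upper {a} u u<a with parity-split u
  ... | inj₁ even = NonNeg-resp
    (trans (cong (λ e → + 4 * + u - (+ u * (+ u + + 3 - + a) + + a * e)) even) (ring (+ a) (+ u)))
    (nat u ⊠ (gap u<a ⊹ nat 2))
    where
    ring : ∀ a u → + 4 * u - (u * (u + + 3 - a) + a * 0ℤ) ≡ u * (a - (1ℤ + u) + + 2)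
    ring = solve-∀
  Ψ-4u-upper {a} (suc u) u<a | inj₂ odd = NonNeg-resp
    (trans (cong (λ e → + 4 * + suc u - (+ suc u * (+ suc u + + 3 - + a) + + a * e)) odd) (ring (+ a) (+ u)))
    (nat u ⊠ (gap u<a ⊹ nat 1))
    where
    ring : ∀ a u → + 4 * (1ℤ + u) - ((1ℤ + u) * (1ℤ + u + + 3 - a) + a * 1ℤ) ≡
      u * (a - (1ℤ + (1ℤ + u)) + 1ℤ)
    ring = solve-∀

  module _ {b v} (v<b : v ℕ.< b) where
    private
      B V : ℤ
      B = + b
      V = + v

      0<B : NonNeg (B - 1ℤ)
      0<B = gap (ℕ.≤-<-trans z≤n v<b)

    Φ-lower : NonNeg (Φ b v + (B - 1ℤ) * (B - 1ℤ))
    Φ-lower = NonNeg-resp (ring B V) (square (B - 1ℤ - V) ⊹ nat v ⊠ 0<B ⊹ nat v)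
      where
      ring : ∀ b v → v * (v + + 2 - b) + (b - 1ℤ) * (b - 1ℤ) ≡
        (b - 1ℤ - v) * (b - 1ℤ - v) + v * (b - 1ℤ) + v
      ring = solve-∀

    Φ-upper : NonNeg (B - Φ b v)
    Φ-upper = NonNeg-resp (ring B V) (gap v<b ⊹ nat 1 ⊹ nat v ⊠ gap v<b)
      where
      ring : ∀ b v → b - v * (v + + 2 - b) ≡ b - (1ℤ + v) + 1ℤ + v * (b - (1ℤ + v))
      ring = solve-∀

    Φ-2v-lower : NonNeg (Φ b v - + 2 * V + B * B)
    Φ-2v-lower = NonNeg-resp (ring B V) (nat v ⊠ nat v ⊹ nat b ⊠ (gap v<b ⊹ nat 1))
      where
      ring : ∀ b v → v * (v + + 2 - b) - + 2 * v + b * b ≡ v * v + b * (b - (1ℤ + v) + 1ℤ)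
      ring = solve-∀

    Φ-2v-upper : NonNeg (+ 2 * V - Φ b v)
    Φ-2v-upper = NonNeg-resp (ring B V) (nat v ⊠ (gap v<b ⊹ nat 1))
      where
      ring : ∀ b v → + 2 * v - v * (v + + 2 - b) ≡ v * (b - (1ℤ + v) + 1ℤ)
      ring = solve-∀

  invariant-upper : ∀ {a b c n u v Ψ Φ} → NonNeg a → NonNeg b → NonNeg c → NonNeg n →
    NonNeg (+ 4 * u - Ψ) → NonNeg (+ 2 * v - Φ) →
    NonNeg (+ 4 * a * b * c + + 2 * b * b
      - (+ 4 * a * b * c + + 2 * n * (b - n) + b * c * (Ψ - + 4 * u) + + 2 * a * c * (Φ - + 2 * v)))
  invariant-upper {a} {b} {c} {n} {u} {v} {Ψ} {Φ} 0≤a 0≤b 0≤c 0≤n Ψ≤ Φ≤ = NonNeg-resp (ring a b c n u v Ψ Φ)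
    (square (b - n) ⊹ 0≤b ⊠ 0≤b ⊹ 0≤n ⊠ 0≤n ⊹ 0≤b ⊠ 0≤c ⊠ Ψ≤ ⊹ nat 2 ⊠ 0≤a ⊠ 0≤c ⊠ Φ≤)
    where
    ring : ∀ a b c n u v Ψ Φ → + 4 * a * b * c + + 2 * b * b
      - (+ 4 * a * b * c + + 2 * n * (b - n) + b * c * (Ψ - + 4 * u) + + 2 * a * c * (Φ - + 2 * v))
      ≡ (b - n) * (b - n) + b * b + n * n + b * c * (+ 4 * u - Ψ) + + 2 * a * c * (+ 2 * v - Φ)
    ring = solve-∀

  invariant-lower : ∀ {a b c n u v Ψ Φ} → NonNeg a → NonNeg b → NonNeg c → NonNeg n → NonNeg (c - n) →
    NonNeg (Ψ - + 4 * u + a * a) → NonNeg (Φ - + 2 * v + b * b) →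
    NonNeg (+ 4 * a * b * c + + 2 * n * (b - n) + b * c * (Ψ - + 4 * u) + + 2 * a * c * (Φ - + 2 * v)
      - (+ 4 * a * b * c - + 2 * c * c - a * a * b * c - + 2 * a * b * b * c))
  invariant-lower {a} {b} {c} {n} {u} {v} {Ψ} {Φ} 0≤a 0≤b 0≤c 0≤n n≤c ≤Ψ ≤Φ = NonNeg-resp (ring a b c n u v Ψ Φ)
    (nat 2 ⊠ (0≤n ⊠ 0≤b ⊹ n≤c ⊠ (0≤c ⊹ 0≤n)) ⊹ 0≤b ⊠ 0≤c ⊠ ≤Ψ ⊹ nat 2 ⊠ 0≤a ⊠ 0≤c ⊠ ≤Φ)
    where
    ring : ∀ a b c n u v Ψ Φ →
      + 4 * a * b * c + + 2 * n * (b - n) + b * c * (Ψ - + 4 * u) + + 2 * a * c * (Φ - + 2 * v)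
      - (+ 4 * a * b * c - + 2 * c * c - a * a * b * c - + 2 * a * b * b * c)
      ≡ + 2 * (n * b + (c - n) * (c + n)) + b * c * (Ψ - + 4 * u + a * a) + + 2 * a * c * (Φ - + 2 * v + b * b)
    ring = solve-∀

  -- In both lemmas what is left after the given bounds is a polynomial in
  -- x = a − 1 and y = b − 2 all of whose coefficients are nonnegative.
  upper-from-invariant : ∀ {a b n q Ψ Φ} → let c = a + + 2 * b in
    NonNeg a → NonNeg b → NonNeg (a - 1ℤ) → NonNeg (b - + 2) →
    NonNeg (+ 4 * a * b * c + + 2 * b * b
      - (+ 2 * (+ 2 * (a * b * c) * q - n * n - n * (a + b + c)) + b * c * Ψ + + 2 * a * c * Φ)) →
    NonNeg (Ψ + (a - 1ℤ) * (a - 1ℤ)) → NonNeg (Φ + (b - 1ℤ) * (b - 1ℤ)) →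
    NonNeg (+ 2 * (n * n + n * (a + b + c)
      + (+ 2 * a * a * b * b * c - (a + b) * a * b * c + + 2 * a * b * c + a + b - + 2 * a * b)
      - + 2 * (a * b * c) * q))
  upper-from-invariant {a} {b} {n} {q} {Ψ} {Φ} 0≤a 0≤b 0≤x 0≤y X≤ ≤Ψ ≤Φ = NonNeg-resp (ring a b n q Ψ Φ)
    (X≤ ⊹ 0≤b ⊠ 0≤c ⊠ ≤Ψ ⊹ nat 2 ⊠ 0≤a ⊠ 0≤c ⊠ ≤Φ
      ⊹ (0≤y ⊠ (nat 4 ⊹ 0≤y ⊠ nat 2)
        ⊹ 0≤x ⊠ (nat 66 ⊹ 0≤y ⊠ (nat 106 ⊹ 0≤y ⊠ (nat 52 ⊹ 0≤y ⊠ nat 8))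
        ⊹ 0≤x ⊠ (nat 64 ⊹ 0≤y ⊠ (nat 101 ⊹ 0≤y ⊠ (nat 50 ⊹ 0≤y ⊠ nat 8))
        ⊹ 0≤x ⊠ (nat 10 ⊹ 0≤y ⊠ (nat 13 ⊹ 0≤y ⊠ nat 4))))))
    where
    0≤c = 0≤a ⊹ nat 2 ⊠ 0≤b
    ring : ∀ a b n q Ψ Φ → let c = a + + 2 * b in let x = a - 1ℤ in let y = b - + 2 in
      + 2 * (n * n + n * (a + b + c)
        + (+ 2 * a * a * b * b * c - (a + b) * a * b * c + + 2 * a * b * c + a + b - + 2 * a * b)
        - + 2 * (a * b * c) * q)
      ≡ + 4 * a * b * c + + 2 * b * b
        - (+ 2 * (+ 2 * (a * b * c) * q - n * n - n * (a + b + c)) + b * c * Ψ + + 2 * a * c * Φ)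
        + b * c * (Ψ + (a - 1ℤ) * (a - 1ℤ)) + + 2 * a * c * (Φ + (b - 1ℤ) * (b - 1ℤ))
        + (y * (+ 4 + y * + 2)
          + x * (+ 66 + y * (+ 106 + y * (+ 52 + y * + 8))
          + x * (+ 64 + y * (+ 101 + y * (+ 50 + y * + 8))
          + x * (+ 10 + y * (+ 13 + y * + 4)))))
    ring = solve-∀

  lower-from-invariant : ∀ {a b n q Ψ Φ} → let c = a + + 2 * b in
    NonNeg a → NonNeg b → NonNeg (a - 1ℤ) → NonNeg (b - + 2) →
    NonNeg (+ 2 * (+ 2 * (a * b * c) * q - n * n - n * (a + b + c)) + b * c * Ψ + + 2 * a * c * Φ
      - (+ 4 * a * b * c - + 2 * c * c - a * a * b * c - + 2 * a * b * b * c)) →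
    NonNeg (+ 4 * a - Ψ) → NonNeg (b - Φ) →
    NonNeg (+ 2 * (+ 2 * (a * b * c) * q - (n * n + n * (a + b + c)
      + (- (+ 2 * a * a * b * b * c) - (a + b) * a * b * c + a + b + + 2 * a * b))))
  lower-from-invariant {a} {b} {n} {q} {Ψ} {Φ} 0≤a 0≤b 0≤x 0≤y ≤X Ψ≤ Φ≤ = NonNeg-resp (ring a b n q Ψ Φ)
    (≤X ⊹ 0≤b ⊠ 0≤c ⊠ Ψ≤ ⊹ nat 2 ⊠ 0≤a ⊠ 0≤c ⊠ Φ≤
      ⊹ (nat 6 ⊹ 0≤y ⊠ (nat 57 ⊹ 0≤y ⊠ (nat 42 ⊹ 0≤y ⊠ nat 8))
        ⊹ 0≤x ⊠ (nat 144 ⊹ 0≤y ⊠ (nat 227 ⊹ 0≤y ⊠ (nat 108 ⊹ 0≤y ⊠ nat 16))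
        ⊹ 0≤x ⊠ (nat 120 ⊹ 0≤y ⊠ (nat 153 ⊹ 0≤y ⊠ (nat 62 ⊹ 0≤y ⊠ nat 8))
        ⊹ 0≤x ⊠ (nat 18 ⊹ 0≤y ⊠ (nat 17 ⊹ 0≤y ⊠ nat 4))))))
    where
    0≤c = 0≤a ⊹ nat 2 ⊠ 0≤b
    ring : ∀ a b n q Ψ Φ → let c = a + + 2 * b in let x = a - 1ℤ in let y = b - + 2 in
      + 2 * (+ 2 * (a * b * c) * q - (n * n + n * (a + b + c)
        + (- (+ 2 * a * a * b * b * c) - (a + b) * a * b * c + a + b + + 2 * a * b)))
      ≡ + 2 * (+ 2 * (a * b * c) * q - n * n - n * (a + b + c)) + b * c * Ψ + + 2 * a * c * Φ
        - (+ 4 * a * b * c - + 2 * c * c - a * a * b * c - + 2 * a * b * b * c)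
        + b * c * (+ 4 * a - Ψ) + + 2 * a * c * (b - Φ)
        + (+ 6 + y * (+ 57 + y * (+ 42 + y * + 8))
          + x * (+ 144 + y * (+ 227 + y * (+ 108 + y * + 16))
          + x * (+ 120 + y * (+ 153 + y * (+ 62 + y * + 8))
          + x * (+ 18 + y * (+ 17 + y * + 4)))))
    ring = solve-∀

  module Bounds (a b c : ℕ) (a<b : a ℕ.< b)
    .{{a≢0 : NonZero a}} .{{b≢0 : NonZero b}} .{{c≢0 : NonZero c}}
    (c≡ : + c ≡ + a + + 2 * + b) (odd : parity a ≡ 1ℤ) (a⊥b : Coprime a b)
    (p : Series) (δp≗𝟙 : δ a (δ b (δ c p)) ≗ 𝟙) where

    open Denumerant a b a⊥b

    private
      A B C : ℤ
      A = + a
      B = + b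
      C = A + + 2 * B

      h : Series
      h = δ c p

      h≡k+1 : ∀ n u v k → Rep n u v k → h n ≡ k + 1ℤ
      h≡k+1 = denumerant δp≗𝟙 (λ _ → refl)

      0≤C : NonNeg C
      0≤C = nat a ⊹ nat 2 ⊠ nat b

      -- The invariant of n ↦ n − c, with q = p(n), N = n, ψ = Ψ(u), ϕ = Φ(v).
      X-form : ℤ → ℤ → ℤ → ℤ → ℤ
      X-form q N ψ ϕ = + 2 * (+ 2 * (A * B * C) * q - N * N - N * (A + B + C))
        + B * C * ψ + + 2 * A * C * ϕ

      X : ℕ → ℕ → ℕ → ℤ
      X n u v = X-form (p n) (+ n) (Ψ a u) (Φ b v)

      hi lo : ℤ
      hi = + 4 * A * B * C + + 2 * B * B
      lo = + 4 * A * B * C - + 2 * C * C - A * A * B * C - + 2 * A * B * B * C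

      X-step : ∀ n u v k → Rep (c ℕ.+ n) u v k →
        ∃₂ λ u′ v′ → ∃ λ k′ → Rep n u′ v′ k′ × X (c ℕ.+ n) u v ≡ X n u′ v′
      X-step n u v k rep@(u<a , v<b , eq) with Ψ-step a u odd u<a | Φ-step b v v<b
      ... | u′ , i , u′<a , u≡ , Ψ≡ | v′ , j , v′<b , v≡ , Φ≡ =
        u′ , v′ , k - i - j , (u′<a , v′<b , trans n≡ n-rep) , (begin
          X (c ℕ.+ n) u v
            ≡⟨ cong₂ (λ q N → X-form q N (Ψ a u) (Φ b v))
                 (trans (δ-step p (λ _ → refl) n) (cong (_+_ (p n)) (h≡k+1 (c ℕ.+ n) u v k rep))) eq ⟩
          X-form (p n + (k + 1ℤ)) (B * + u + A * + v + A * B * k) (Ψ a u) (Φ b v)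
            ≡⟨ cong₂ (X-form (p n + (k + 1ℤ)) (B * + u + A * + v + A * B * k)) Ψ≡ Φ≡ ⟩
          X-form (p n + (k + 1ℤ)) (B * + u + A * + v + A * B * k)
            (Ψ a u′ + (+ 4 * + u - + 2 * (A - 1ℤ))) (Φ b v′ + (+ 2 * + v - (B - 1ℤ)))
            ≡⟨ ring₄ A B (+ u) (+ v) k (p n) (Ψ a u′) (Φ b v′) ⟩
          X-form (p n) (B * (+ u - + 2) + A * (+ v - 1ℤ) + A * B * k) (Ψ a u′) (Φ b v′)
            ≡⟨ cong (λ N → X-form (p n) N (Ψ a u′) (Φ b v′)) n≡ ⟨
          X n u′ v′ ∎)
        where
        open ≡-Reasoning
        ring₁ : ∀ c n → n ≡ (c + n) - c
        ring₁ = solve-∀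
        ring₂ : ∀ a b u v k → b * u + a * v + a * b * k - (a + + 2 * b) ≡
          b * (u - + 2) + a * (v - 1ℤ) + a * b * k
        ring₂ = solve-∀
        ring₃ : ∀ a b u v i j k → b * (u - a * i) + a * (v - b * j) + a * b * k ≡
          b * u + a * v + a * b * (k - i - j)
        ring₃ = solve-∀
        ring₄ : ∀ a b u v k p Ψ Φ →
          let c = a + + 2 * b
              n = b * u + a * v + a * b * k
              m = b * (u - + 2) + a * (v - 1ℤ) + a * b * k
          in + 2 * (+ 2 * (a * b * c) * (p + (k + 1ℤ)) - n * n - n * (a + b + c))
               + b * c * (Ψ + (+ 4 * u - + 2 * (a - 1ℤ))) + + 2 * a * c * (Φ + (+ 2 * v - (b - 1ℤ)))
           ≡ + 2 * (+ 2 * (a * b * c) * p - m * m - m * (a + b + c)) + b * c * Ψ + + 2 * a * c * Φ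
        ring₄ = solve-∀
        n≡ : + n ≡ B * (+ u - + 2) + A * (+ v - 1ℤ) + A * B * k
        n≡ = begin
          + n                                             ≡⟨ ring₁ C (+ n) ⟩
          (C + + n) - C                                   ≡⟨ cong (λ x → x + + n - C) c≡ ⟨
          + (c ℕ.+ n) - C                                 ≡⟨ cong (_- C) eq ⟩
          B * + u + A * + v + A * B * k - C               ≡⟨ ring₂ A B (+ u) (+ v) k ⟩
          B * (+ u - + 2) + A * (+ v - 1ℤ) + A * B * k    ∎
        n-rep : B * (+ u - + 2) + A * (+ v - 1ℤ) + A * B * k ≡
          B * + u′ + A * + v′ + A * B * (k - i - j)
        n-rep = trans (cong₂ (λ x y → B * x + A * y + A * B * k) u≡ v≡)
          (ring₃ A B (+ u′) (+ v′) i j k)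

      X-base : ∀ n u v k → n ℕ.< c → Rep n u v k →
        X n u v ≡ + 4 * A * B * C + + 2 * + n * (B - + n)
          + B * C * (Ψ a u - + 4 * + u) + + 2 * A * C * (Φ b v - + 2 * + v)
      X-base n u v k n<c rep@(_ , _ , eq) = begin
        X n u v
          ≡⟨ cong₂ (λ q N → X-form q N (Ψ a u) (Φ b v))
               (trans (δ-base p (λ _ → refl) n<c) (h≡k+1 n u v k rep)) eq ⟩
        _ ≡⟨ ring A B (+ u) (+ v) k (Ψ a u) (Φ b v) ⟩
        _ ≡⟨ cong (λ N → + 4 * A * B * C + + 2 * N * (B - N)
               + B * C * (Ψ a u - + 4 * + u) + + 2 * A * C * (Φ b v - + 2 * + v)) eq ⟨
        _ ∎
        where
        open ≡-Reasoning
        ring : ∀ a b u v k Ψ Φ →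
          let c = a + + 2 * b
              n = b * u + a * v + a * b * k
          in + 2 * (+ 2 * (a * b * c) * (k + 1ℤ) - n * n - n * (a + b + c)) + b * c * Ψ + + 2 * a * c * Φ
           ≡ + 4 * a * b * c + + 2 * n * (b - n) + b * c * (Ψ - + 4 * u) + + 2 * a * c * (Φ - + 2 * v)
        ring = solve-∀

      X-bounds : ∀ n u v k → Rep n u v k → NonNeg (hi - X n u v) × NonNeg (X n u v - lo)
      X-bounds = stride-induction c
        (λ n → ∀ u v k → Rep n u v k → NonNeg (hi - X n u v) × NonNeg (X n u v - lo)) base step
        where
        base : ∀ n → n ℕ.< c → ∀ u v k → Rep n u v k → NonNeg (hi - X n u v) × NonNeg (X n u v - lo)
        base n n<c u v k rep@(u<a , v<b , _) =
          NonNeg-resp (cong (_-_ hi) X≡)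
            (invariant-upper {A} {B} {C} {+ n} {+ u} {+ v} {Ψ a u} {Φ b v} (nat a) (nat b) 0≤C (nat n)
              (Ψ-4u-upper u u<a) (Φ-2v-upper v<b)) ,
          NonNeg-resp (cong (_- lo) X≡)
            (invariant-lower {A} {B} {C} {+ n} {+ u} {+ v} {Ψ a u} {Φ b v} (nat a) (nat b) 0≤C (nat n) n≤C
              (Ψ-4u-lower u<a) (Φ-2v-lower v<b))
          where
          X≡ = X-base n u v k n<c rep
          n≤C : NonNeg (C - + n)
          n≤C = subst (λ x → NonNeg (x - + n)) c≡ (ℤ.i≤j⇒0≤j-i (ℤ.+≤+ (ℕ.<⇒≤ n<c)))
        step : ∀ n → (∀ u v k → Rep n u v k → NonNeg (hi - X n u v) × NonNeg (X n u v - lo)) →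
          ∀ u v k → Rep (c ℕ.+ n) u v k → NonNeg (hi - X (c ℕ.+ n) u v) × NonNeg (X (c ℕ.+ n) u v - lo)
        step n ih u v k rep =
          let u′ , v′ , k′ , rep′ , X≡ = X-step n u v k rep
          in subst (λ x → NonNeg (hi - x) × NonNeg (x - lo)) (sym X≡) (ih u′ v′ k′ rep′)

      halve : ∀ {x} → NonNeg (+ 2 * x) → NonNeg x
      halve {x} = ℤ.*-cancelˡ-≤-pos 0ℤ x (+ 2)

      1<b : NonNeg (B - + 2)
      1<b = gap (ℕ.≤-<-trans (ℕ.>-nonZero⁻¹ a) a<b)

    upper : ∀ n → NonNeg (+ n * + n + + n * (A + B + C)
      + (+ 2 * A * A * B * B * C - (A + B) * A * B * C + + 2 * A * B * C + A + B - + 2 * A * B)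
      - + 2 * (A * B * C) * p n)
    upper n =
      let u , v , k , rep = represent n
          u<a , v<b , _ = rep
      in halve (upper-from-invariant {A} {B} {+ n} {p n} {Ψ a u} {Φ b v} (nat a) (nat b) 0<A 1<b
           (proj₁ (X-bounds n u v k rep)) (Ψ-lower u<a) (Φ-lower v<b))

    lower : ∀ n → NonNeg (+ 2 * (A * B * C) * p n - (+ n * + n + + n * (A + B + C)
      + (- (+ 2 * A * A * B * B * C) - (A + B) * A * B * C + A + B + + 2 * A * B)))
    lower n =
      let u , v , k , rep = represent n
          u<a , v<b , _ = rep
      in halve (lower-from-invariant {A} {B} {+ n} {p n} {Ψ a u} {Φ b v} (nat a) (nat b) 0<A 1<b
           (proj₂ (X-bounds n u v k rep)) (Ψ-upper u<a) (Φ-upper v<b))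

  P₂-numerator : ℤ → ℤ → ℤ → ℤ
  P₂-numerator R S N = - 1ℤ + N ^ 2 + + 3 * R + N * (+ 3 * R - S) - S

  Cᵘ-numerator : ℤ → ℤ → ℤ
  Cᵘ-numerator R S =
      ( R ^ 3 * (+ 4 * S ^ 2 - + 2 * S)
      + R ^ 2 * (- (+ 10 * S ^ 3) + + 3 * S ^ 2 + + 4 * S)
      + R * (+ 8 * S ^ 4 - S ^ 3 - + 6 * S ^ 2 - + 2 * S - + 2)
      - + 2 * S ^ 5 + + 2 * S ^ 3 + + 2 * S ^ 2 + S + 1ℤ )

  upper-numerator : ∀ {R} S B N → R ≡ S + B → let C = S + + 2 * B in
    P₂-numerator R S N + Cᵘ-numerator R S ≡
    N * N + N * (S + B + C)
      + (+ 2 * S * S * B * B * C - (S + B) * S * B * C + + 2 * S * B * C + S + B - + 2 * S * B)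
  upper-numerator S B N refl = ring S B N
    where
    ring : ∀ S B N → let
          R = S + B
          C = S + + 2 * B
          N^2 = N * (N * 1ℤ)
          R^2 = R * (R * 1ℤ)
          R^3 = R * R^2
          S^2 = S * (S * 1ℤ)
          S^3 = S * S^2
          S^4 = S * S^3
          S^5 = S * S^4
      in - 1ℤ + N^2 + + 3 * R + N * (+ 3 * R - S) - S +
        ( R^3 * (+ 4 * S^2 - + 2 * S)
        + R^2 * (- (+ 10 * S^3) + + 3 * S^2 + + 4 * S)
        + R * (+ 8 * S^4 - S^3 - + 6 * S^2 - + 2 * S - + 2)
        - + 2 * S^5 + + 2 * S^3 + + 2 * S^2 + S + 1ℤ ) ≡
        N * N + N * (S + B + C)
          + (+ 2 * S * S * B * B * C - (S + B) * S * B * C + + 2 * S * B * C + S + B - + 2 * S * B)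
    ring = solve-∀

  Cᵈ-numerator : ℤ → ℤ → ℤ
  Cᵈ-numerator R S =
      ( R ^ 3 * (- (+ 4 * S ^ 2) - + 2 * S)
      + R ^ 2 * (+ 10 * S ^ 3 + + 3 * S ^ 2)
      + R * (- (+ 8 * S ^ 4) - S ^ 3 + + 2 * S - + 2)
      + + 2 * S ^ 5 - + 2 * S ^ 2 + S + 1ℤ )

  lower-numerator : ∀ {R} S B N → R ≡ S + B → let C = S + + 2 * B in
    P₂-numerator R S N + Cᵈ-numerator R S ≡
    N * N + N * (S + B + C)
      + (- (+ 2 * S * S * B * B * C) - (S + B) * S * B * C + S + B + + 2 * S * B)
  lower-numerator S B N refl = ring S B N
    where
    ring : ∀ S B N → let
          R = S + B
          C = S + + 2 * B
          N^2 = N * (N * 1ℤ)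
          R^2 = R * (R * 1ℤ)
          R^3 = R * R^2
          S^2 = S * (S * 1ℤ)
          S^3 = S * S^2
          S^4 = S * S^3
          S^5 = S * S^4
      in - 1ℤ + N^2 + + 3 * R + N * (+ 3 * R - S) - S +
        ( R^3 * (- (+ 4 * S^2) - + 2 * S)
        + R^2 * (+ 10 * S^3 + + 3 * S^2)
        + R * (- (+ 8 * S^4) - S^3 + + 2 * S - + 2)
        + + 2 * S^5 - + 2 * S^2 + S + 1ℤ ) ≡
        N * N + N * (S + B + C)
          + (- (+ 2 * S * S * B * B * C) - (S + B) * S * B * C + S + B + + 2 * S * B)
    ring = solve-∀

  parity-0⇒even : ∀ n → parity n ≡ 0ℤ → 2 ∣ n
  parity-0⇒even 0             _ = 2 ∣0
  parity-0⇒even (suc (suc n)) e = ∣m∣n⇒∣m+n ∣-refl (parity-0⇒even n e)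

  odd⇒parity-1 : ∀ {n} → 2 ∤ n → parity n ≡ 1ℤ
  odd⇒parity-1 {n} 2∤n with parity-split n
  ... | inj₁ e = ⊥-elim (2∤n (parity-0⇒even n e))
  ... | inj₂ e = e

  toℚᵘ-/ : ∀ x d .{{_ : NonZero d}} → ℚ.toℚᵘ (x / d) ℚᵘ.≃ x ℚᵘ./ d
  toℚᵘ-/ x (suc d) = ℚ.toℚᵘ-fromℚᵘ (ℚᵘ.mkℚᵘ x d)

  toℚᵘ-/-+ : ∀ x y d .{{_ : NonZero d}} → ℚ.toℚᵘ (x / d ℚ.+ y / d) ℚᵘ.≃ (x + y) ℚᵘ./ d
  toℚᵘ-/-+ x y d@(suc _) = ℚᵘ.≃-trans (ℚ.toℚᵘ-homo-+ (x / d) (y / d))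
    (ℚᵘ.≃-trans (ℚᵘ.+-cong (toℚᵘ-/ x d) (toℚᵘ-/ y d)) (ℚᵘ.*≡* (ring x y (+ d))))
    where
    ring : ∀ x y d → (x * d + y * d) * d ≡ (x + y) * (d * d)
    ring = solve-∀

  x/d+y/d≤z/1 : ∀ x y z d .{{_ : NonZero d}} → x + y ℤ.≤ z * + d → x / d ℚ.+ y / d ℚ.≤ z / 1
  x/d+y/d≤z/1 x y z d@(suc _) le = ℚ.toℚᵘ-cancel-≤
    (ℚᵘ.≤-respˡ-≃ (ℚᵘ.≃-sym (toℚᵘ-/-+ x y d)) (ℚᵘ.≤-respʳ-≃ (ℚᵘ.≃-sym (toℚᵘ-/ z 1))
      (ℚᵘ.*≤* (subst (ℤ._≤ z * + d) (sym (ℤ.*-identityʳ (x + y))) le))))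

  z/1≤x/d+y/d : ∀ x y z d .{{_ : NonZero d}} → z * + d ℤ.≤ x + y → z / 1 ℚ.≤ x / d ℚ.+ y / d
  z/1≤x/d+y/d x y z d@(suc _) le = ℚ.toℚᵘ-cancel-≤
    (ℚᵘ.≤-respʳ-≃ (ℚᵘ.≃-sym (toℚᵘ-/-+ x y d)) (ℚᵘ.≤-respˡ-≃ (ℚᵘ.≃-sym (toℚᵘ-/ z 1))
      (ℚᵘ.*≤* (subst (z * + d ℤ.≤_) (sym (ℤ.*-identityʳ (x + y))) le))))

open Counting
open import Data.Nat.Base using (ℕ; _≤_; _<_; _*_)

lemma4p2 : (r s : ℕ) → Coprime r s → 2 ∤ s → (1≤s : 1 ≤ s) → (2s<r : 2 * s < r) →
    (p : Series) → p IsReciprocalOf denominator r s →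
    let instance nz = Δ₂-nonZero r s 1≤s 2s<r in
    (n : ℕ) →
    (P₂ r s n ℚ.+ Cᵈ r s ℚ.≤ p n / 1) × (p n / 1 ℚ.≤ P₂ r s n ℚ.+ Cᵘ r s)
lemma4p2 r s r⊥s 2∤s 1≤s 2s<r p p-inv n =
  x/d+y/d≤z/1 (P₂-numerator (+ r) (+ s) (+ n)) (Cᵈ-numerator (+ r) (+ s)) (p n)
    (2 * Δ₂ r s) {{2Δ≢0}} (ℤ.0≤i-j⇒j≤i
    (NonNeg-resp (cong₂ ℤ._-_ pn*2Δ≡ (lower-numerator (+ s) (+ b) (+ n) r≡)) (lower n))) ,
  z/1≤x/d+y/d (P₂-numerator (+ r) (+ s) (+ n)) (Cᵘ-numerator (+ r) (+ s)) (p n)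
    (2 * Δ₂ r s) {{2Δ≢0}} (ℤ.0≤i-j⇒j≤i
    (NonNeg-resp (cong₂ ℤ._-_ (upper-numerator (+ s) (+ b) (+ n) r≡) pn*2Δ≡) (upper n)))
  where
  b c : ℕ
  b = r ∸ s
  c = 2 * r ∸ s

  s<b : s < b
  s<b = ℕ.m+n≤o⇒m≤o∸n (suc s)
    (subst (_< r) (cong (s ℕ.+_) (ℕ.+-identityʳ s)) 2s<r)

  s+b≡r : s ℕ.+ b ≡ r
  s+b≡r = ℕ.m+[n∸m]≡n (ℕ.≤-trans (ℕ.m≤m+n s _) (ℕ.<⇒≤ 2s<r))

  c≡s+2b : c ≡ s ℕ.+ 2 * b
  c≡s+2b = trans (cong (λ x → 2 * x ∸ s) (sym s+b≡r))
    (trans (cong (_∸ s) (ring s b)) (ℕ.m+n∸m≡n s (s ℕ.+ 2 * b)))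
    where
    ring : ∀ s b → 2 * (s ℕ.+ b) ≡ s ℕ.+ (s ℕ.+ 2 * b)
    ring = ℕ-Solver.solve-∀

  instance
    s≢0 : NonZero s
    s≢0 = ℕ.>-nonZero 1≤s

    b≢0 : NonZero b
    b≢0 = ℕ.>-nonZero (ℕ.≤-<-trans z≤n s<b)

    c≢0 : NonZero c
    c≢0 = subst NonZero (sym c≡s+2b)
      (ℕ.>-nonZero (ℕ.≤-trans 1≤s (ℕ.m≤m+n s _)))

  2Δ≢0 : NonZero (2 * Δ₂ r s)
  2Δ≢0 = ℕ.m*n≢0 2 (Δ₂ r s) {{_}} {{Δ₂-nonZero r s 1≤s 2s<r}}

  s⊥b : Coprime s b
  s⊥b (d∣s , d∣b) = r⊥s (subst (_ ∣_) s+b≡r (∣m∣n⇒∣m+n d∣s d∣b) , d∣s)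

  r≡ : + r ≡ + s ℤ.+ + b
  r≡ = cong +_ (sym s+b≡r)

  c≡ : + c ≡ + s ℤ.+ + 2 ℤ.* + b
  c≡ = trans (cong +_ c≡s+2b) (cong (ℤ._+_ (+ s)) (ℤ.pos-* 2 b))

  2Δ≡ : + (2 * Δ₂ r s) ≡ + 2 ℤ.* (+ s ℤ.* + b ℤ.* (+ s ℤ.+ + 2 ℤ.* + b))
  2Δ≡ = trans (ℤ.pos-* 2 (Δ₂ r s)) (cong (ℤ._*_ (+ 2))
    (trans (ℤ.pos-* (s * b) c) (cong₂ ℤ._*_ (ℤ.pos-* s b) c≡)))

  pn*2Δ≡ : p n ℤ.* + (2 * Δ₂ r s) ≡
    + 2 ℤ.* (+ s ℤ.* + b ℤ.* (+ s ℤ.+ + 2 ℤ.* + b)) ℤ.* p n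
  pn*2Δ≡ = trans (ℤ.*-comm (p n) _) (cong (ℤ._* p n) 2Δ≡)

  open Bounds s b c s<b c≡ (odd⇒parity-1 2∤s) s⊥b p (reciprocal⇒δ s b c p p-inv)
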